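{- Let $n \ge 10$ be an integer. There exists an $n$-unexceptional $2$-connected graph $G$ of order $n$ such that $\eta(G) = 2n$.
   Context: All graphs are finite, simple and connected; the order of a graph is its number of vertices. Let $d_G(u,v)$ be the usual shortest-path distance. The Wiener index is $W(G)=\sum_{\{u,v\}\subseteq V(G)} d_G(u,v)$, the sum being over unordered pairs of distinct vertices. For an edge $ab\in E(G)$ let $n_{ab}(a)=|\{c\in V(G): d_G(c,a)<d_G(c,b)\}|$ and $n_{ab}(b)=|\{c\in V(G): d_G(c,b)<d_G(c,a)\}|$. The Szeged index is $Sz(G)=\sum_{ab\in E(G)} n_{ab}(a)\,n_{ab}(b)$. The Szeged--Wiener gap is $\eta(G)=Sz(G)-W(G)$. For integers $n,t$ with $1\le t\le n-1$, $K_n^t$ denotes the graph of order $n$ obtained from the complete graph $K_{n-1}$ by adding one new vertex adjacent to exactly $t$ vertices of $K_{n-1}$. A graph $G$ is $n$-exceptional if it is isomorphic to one of $K_n$, $K_n^2$, $K_n^{n-2}$, and $n$-unexceptional otherwise. -}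

module Defs where

open import Data.Bool.Base using (if_then_else_)
open import Data.Empty using (⊥)
open import Data.Fin.Base using (Fin; zero; suc; toℕ; punchIn)
open import Data.Fin.Properties as Fin using (any?)
open import Data.Fin.Permutation using (Permutation; _⟨$⟩ʳ_)
open import Data.Fin.Subset using (Subset; _∈_)
open import Data.Fin.Subset.Properties using (_∈?_)
open import Data.Integer.Base using (ℤ; +_; _-_)
open import Data.Nat.Base using (ℕ; zero; suc; pred; _*_; _∸_; _≤_; z≤n; s≤s)
open import Data.Nat.Properties using (_<?_; +-0-commutativeMonoid)
open import Data.Product.Base using (∃; Σ-syntax; _×_; _,_; proj₁)
open import Data.Sum.Base using (_⊎_)
open import Data.Vec.Base using (tabulate; allFin; count)
open import Function.Base using (_∘_)
open import Function.Bundles using (_⇔_)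
open import Level using (0ℓ)
open import Relation.Binary.Core using (Rel)
open import Relation.Binary.Definitions as B using (Symmetric)
open import Relation.Binary.PropositionalEquality using (_≡_; _≢_; refl; sym)
open import Relation.Nullary using (¬_; Dec; yes; no; does; contradiction)
open import Relation.Nullary.Decidable using (map′; _×-dec_; ¬?)
open import Relation.Unary using (Pred; Decidable)

open import Algebra.Properties.CommutativeMonoid.Sum +-0-commutativeMonoid
  using (sum-syntax)

-- Finite simple graphs of order n, with vertex set Fin n.
record Graph (n : ℕ) : Set₁ where
  field
    Adj    : Rel (Fin n) 0ℓ
    adj?   : B.Decidable Adj
    symm   : Symmetric Adj
    irrefl : ∀ v → ¬ Adj v v

open Graph

infix 4 _≅_

_≅_ : ∀ {m n} → Graph m → Graph n → Set
_≅_ {m} {n} G H =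
  Σ[ π ∈ Permutation m n ] (∀ u v → Adj G u v ⇔ Adj H (π ⟨$⟩ʳ u) (π ⟨$⟩ʳ v))

infixr 5 _◅_

data Walk {n : ℕ} (G : Graph n) : ℕ → Fin n → Fin n → Set where
  ε   : ∀ {u} → Walk G 0 u u
  _◅_ : ∀ {k u v w} → Adj G u v → Walk G k v w → Walk G (suc k) u w

walk? : ∀ {n} (G : Graph n) k u v → Dec (Walk G k u v)
walk? G zero    u v = map′ (λ { refl → ε }) (λ { ε → refl }) (u Fin.≟ v)
walk? G (suc k) u v =
  map′ (λ { (_ , e , p) → e ◅ p }) (λ { (e ◅ p) → _ , e , p })
       (any? λ w → adj? G u w ×-dec walk? G k w v)

Connected : ∀ {n} → Graph n → Set
Connected G = ∀ u v → ∃ λ k → Walk G k u v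

delete : ∀ {n} → Graph n → Fin n → Graph (pred n)
delete {suc n} G v = record
  { Adj    = λ i j → Adj G (punchIn v i) (punchIn v j)
  ; adj?   = λ i j → adj? G (punchIn v i) (punchIn v j)
  ; symm   = symm G
  ; irrefl = irrefl G ∘ punchIn v
  }

record TwoConnected {n : ℕ} (G : Graph n) : Set where
  field
    order≥3     : 3 ≤ n
    connected   : Connected G
    noCutVertex : ∀ v → Connected (delete G v)

least : ∀ {P : Pred ℕ 0ℓ} → Decidable P → ∃ P →
        ∃ λ m → P m × (∀ k → P k → m ≤ k)
least P? (k , p) = go P? k p
  where
  go : ∀ {P : Pred ℕ 0ℓ} → Decidable P → ∀ k → P k →
       ∃ λ m → P m × (∀ j → P j → m ≤ j)
  go P? zero p = zero , p , λ _ _ → z≤n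
  go P? (suc k) p with P? zero
  ... | yes p₀ = zero , p₀ , λ _ _ → z≤n
  ... | no ¬p₀ =
    let m , pm , min = go (P? ∘ suc) k p in
    suc m , pm , λ { zero    p₀ → contradiction p₀ ¬p₀
                   ; (suc j) pj → s≤s (min j pj) }

-- The sum over unordered pairs of distinct vertices {u , v}, each listed once,
-- with u < v; only meaningful for summands symmetric in u and v.
sumPairs : ∀ {n} → (Fin n → Fin n → ℕ) → ℕ
sumPairs {n} f = ∑[ u < n ] ∑[ v < n ] (if does (u Fin.<? v) then f u v else 0)

module _ {n : ℕ} (G : Graph n) (conn : Connected G) where

  -- The least length of a walk from u to v; a shortest walk is a path.
  dist : Fin n → Fin n → ℕ
  dist u v = proj₁ (least (λ k → walk? G k u v) (conn u v))

  wiener : ℕ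
  wiener = sumPairs dist

  -- n_{ab}(a); the other factor n_{ab}(b) is closer b a.
  closer : Fin n → Fin n → ℕ
  closer a b = count (λ c → dist c a <? dist c b) (allFin n)

  szeged : ℕ
  szeged = sumPairs λ a b →
    if does (adj? G a b) then closer a b * closer b a else 0

  η : ℤ
  η = + szeged - + wiener

complete : ∀ n → Graph n
complete n = record
  { Adj    = _≢_
  ; adj?   = λ u v → ¬? (u Fin.≟ v)
  ; symm   = λ u≢v v≡u → u≢v (sym v≡u)
  ; irrefl = λ _ v≢v → v≢v refl
  }

-- A new vertex zero, adjacent to exactly the vertices in S.
addVertex : ∀ {m} → Graph m → Subset m → Graph (suc m)
addVertex {m} G S = record
  { Adj = A ; adj? = A? ; symm = λ {u} {v} → A-sym u v ; irrefl = A-irrefl }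
  where
  A : Rel (Fin (suc m)) 0ℓ
  A zero    zero    = ⊥
  A zero    (suc v) = v ∈ S
  A (suc u) zero    = u ∈ S
  A (suc u) (suc v) = Adj G u v

  A? : B.Decidable A
  A? zero    zero    = no λ ()
  A? zero    (suc v) = v ∈? S
  A? (suc u) zero    = u ∈? S
  A? (suc u) (suc v) = adj? G u v

  A-sym : ∀ u v → A u v → A v u
  A-sym zero    (suc v) e = e
  A-sym (suc u) zero    e = e
  A-sym (suc u) (suc v) e = symm G e

  A-irrefl : ∀ v → ¬ A v v
  A-irrefl (suc v) = irrefl G v

-- K n t is Kₙᵗ, intended for 1 ≤ t ≤ n - 1.  The t neighbours of the new vertex
-- are taken to be the first t vertices of Kₙ₋₁; up to isomorphism the choice is
-- immaterial.
K : ∀ n → ℕ → Graph n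
K zero    t = complete zero
K (suc m) t = addVertex (complete m) (tabulate λ i → does (toℕ i <? t))

Exceptional : ∀ {n} → Graph n → Set
Exceptional {n} G = G ≅ complete n ⊎ G ≅ K n 2 ⊎ G ≅ K n (n ∸ 2)

Unexceptional : ∀ {n} → Graph n → Set
Unexceptional G = ¬ Exceptional G

{-# OPTIONS --safe #-}

-- Take a clique on a , b , c₁ , … , c_m, where m = n - 4, and join a to b by a
-- further path a - x - y - b.  The diameter is 2, and with R = C(m , 2), the
-- contribution of the pairs {cᵢ , cⱼ} to either index,
--   W  = 8 + 6m + R,   Sz = 16 + 8m + R,   so that   η = 8 + 2m = 2n.
-- In Kₙ and Kₙᵗ all pairs of non-adjacent vertices share a vertex, whereas
-- {x , b} and {y , a} are disjoint.
module Submission where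

open import Data.Bool.Base using (true; false; if_then_else_)
open import Data.Fin.Base using (Fin; zero; suc)
open import Data.Fin.Patterns using (0F; 1F; 2F; 3F)
open import Data.Fin.Permutation using (_⟨$⟩ʳ_; _⟨$⟩ˡ_; inverseˡ)
import Data.Fin.Properties as Fin
open import Data.Integer.Base using (+_; _-_)
open import Data.Integer.Properties using ([+m]-[+n]≡m⊖n; ⊖-≥)
open import Data.Nat.Base using (ℕ; zero; suc; _+_; _*_; _∸_; _≤_; _≥_; z≤n; s≤s)
open import Data.Nat.Properties
  using (_≟_; _<?_; ≤-antisym; ≤-trans; m≤m+n; m+n∸m≡n; *-identityʳ; *-zeroʳ; m≤n⇒∃[o]m+o≡n;
         +-0-commutativeMonoid)
open import Data.Nat.Tactic.RingSolver using (solve-∀)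
open import Data.Product.Base using (∃; Σ-syntax; _×_; _,_; proj₂)
open import Data.Sum.Base using (_⊎_; inj₁; inj₂)
import Data.Sum.Base as Sum
open import Data.Vec.Base using (tabulate; count)
open import Function.Base using (_∘_; id)
open import Function.Bundles using (Equivalence)
open import Relation.Binary.PropositionalEquality
  using (_≡_; _≢_; refl; sym; trans; cong; cong₂; subst)
open import Relation.Nullary using (¬_; Dec; yes; no; does; contradiction)
open import Relation.Unary using (Pred; Decidable)
open import Level using (0ℓ)
open import Algebra.Properties.CommutativeMonoid.Sum +-0-commutativeMonoid
  using (sum; sum-syntax; sum-cong-≗)
open import Defs

open Graph

private variable
  m n : ℕ

-- Finite sums, counts and sums over pairs.

∑-const : ∀ {f : Fin n → ℕ} {k} → (∀ i → f i ≡ k) → sum f ≡ n * k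
∑-const {zero}  eq = refl
∑-const {suc n} eq = cong₂ _+_ (eq zero) (∑-const (eq ∘ suc))

∑-zero : ∀ {f : Fin n → ℕ} → (∀ i → f i ≡ 0) → sum f ≡ 0
∑-zero {n} eq = trans (∑-const eq) (*-zeroʳ n)

∑-one : ∀ {f : Fin n → ℕ} → (∀ i → f i ≡ 1) → sum f ≡ n
∑-one {n} eq = trans (∑-const eq) (*-identityʳ n)

∑-indicator : ∀ (i : Fin n) → ∑[ j < n ] (if does (j Fin.≟ i) then 1 else 0) ≡ 1
∑-indicator {suc n} zero    = cong suc (∑-zero {n} λ _ → refl)
∑-indicator {suc n} (suc i) = ∑-indicator i

count-tabulate : ∀ {A : Set} {P : Pred A 0ℓ} (P? : Decidable P) (f : Fin n → A) →
                 count P? (tabulate f) ≡ ∑[ i < n ] (if does (P? (f i)) then 1 else 0)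
count-tabulate {zero}  P? f = refl
count-tabulate {suc n} P? f with does (P? (f zero))
... | true  = cong suc (count-tabulate P? (f ∘ suc))
... | false = count-tabulate P? (f ∘ suc)

if-cong : ∀ {P A : Set} (P? : Dec P) {k l z : A} → (P → k ≡ l) →
          (if does P? then k else z) ≡ (if does P? then l else z)
if-cong (yes p) eq = eq p
if-cong (no _)  eq = refl

sumPairs-cong : ∀ {f g : Fin n → Fin n → ℕ} →
                (∀ u v → u ≢ v → f u v ≡ g u v) → sumPairs f ≡ sumPairs g
sumPairs-cong eq =
  sum-cong-≗ λ u → sum-cong-≗ λ v → if-cong (u Fin.<? v) λ u<v → eq u v (Fin.<⇒≢ u<v)

-- Holds by computation: order tests on constructor-headed indices reduce, so entries on or below
-- the diagonal vanish in the first four rows and columns.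
sumPairs-rows : ∀ (f : Fin (4 + m) → Fin (4 + m) → ℕ) {k₀ k₁ k₂ k₃ r} →
  ∑[ v < 3 + m ] f 0F (suc v) ≡ k₀ →
  ∑[ v < 2 + m ] f 1F (suc (suc v)) ≡ k₁ →
  ∑[ v < 1 + m ] f 2F (suc (suc (suc v))) ≡ k₂ →
  ∑[ v < m ] f 3F (suc (suc (suc (suc v)))) ≡ k₃ →
  sumPairs {m} (λ u v → f (suc (suc (suc (suc u)))) (suc (suc (suc (suc v))))) ≡ r →
  sumPairs f ≡ k₀ + (k₁ + (k₂ + (k₃ + r)))
sumPairs-rows f refl refl refl refl refl = refl

+-difference : ∀ {k l d} → k ≡ l + d → + k - + l ≡ + d
+-difference {l = l} {d} refl =
  trans ([+m]-[+n]≡m⊖n (l + d) l)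
  (trans (⊖-≥ (m≤m+n l d)) (cong (λ k → + k) (m+n∸m≡n l d)))

-- Distances and walks in general graphs.

dist-unique : ∀ (G : Graph n) (conn : Connected G) {u v k} → Walk G k u v →
              (∀ {j} → Walk G j u v → k ≤ j) → dist G conn u v ≡ k
dist-unique G conn {u} {v} {k} p shortest
  with least (λ k → walk? G k u v) (conn u v)
... | _ , q , least-q = ≤-antisym (least-q k p) (shortest q)

-- Replaces the searched `dist` by an explicit `d`, so that the terms for concrete vertices can
-- reduce.
closer-∑ : ∀ (G : Graph n) (conn : Connected G) {d : Fin n → Fin n → ℕ} →
           (∀ u v → dist G conn u v ≡ d u v) → ∀ a b →
           closer G conn a b ≡ ∑[ c < n ] (if does (d c a <? d c b) then 1 else 0)
closer-∑ G conn eq a b =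
  trans (count-tabulate (λ c → dist G conn c a <? dist G conn c b) id)
        (sum-cong-≗ λ c → cong₂ (λ k l → if does (k <? l) then 1 else 0) (eq c a) (eq c b))

_◅◅_ : ∀ {G : Graph n} {k l u v w} → Walk G k u v → Walk G l v w → Walk G (k + l) u w
ε       ◅◅ q = q
(e ◅ p) ◅◅ q = e ◅ (p ◅◅ q)

reverse : ∀ (G : Graph n) {k u v} → Walk G k u v → ∃ λ l → Walk G l v u
reverse G ε       = _ , ε
reverse G (e ◅ p) = _ , (proj₂ (reverse G p) ◅◅ (symm G e ◅ ε))

hub-connected : ∀ (G : Graph n) h → (∀ u → ∃ λ k → Walk G k u h) → Connected G
hub-connected G h to u v = _ , (proj₂ (to u) ◅◅ proj₂ (reverse G (proj₂ (to v))))

-- An invariant shared by the exceptional graphs.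

-- Equivalently, some vertex `z` leaves a complete graph when deleted.
NonEdgesMeet : Graph n → Set
NonEdgesMeet G = ∃ λ z → ∀ u v → u ≢ v → ¬ Adj G u v → u ≡ z ⊎ v ≡ z

≅-nonEdgesMeet : ∀ (G : Graph m) (H : Graph n) → G ≅ H → NonEdgesMeet H → NonEdgesMeet G
≅-nonEdgesMeet G H (π , e) (z , meet) =
  π ⟨$⟩ˡ z ,
  λ u v u≢v ¬uv → Sum.map (unapply u) (unapply v)
    (meet (π ⟨$⟩ʳ u) (π ⟨$⟩ʳ v)
      (λ πu≡πv → u≢v (trans (unapply u πu≡πv) (inverseˡ π)))
      (¬uv ∘ Equivalence.from (e u v)))
  where
  unapply : ∀ u {w} → π ⟨$⟩ʳ u ≡ w → u ≡ π ⟨$⟩ˡ w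
  unapply u refl = sym (inverseˡ π)

complete-nonEdgesMeet : NonEdgesMeet (complete (suc n))
complete-nonEdgesMeet = zero , λ u v u≢v ¬uv → contradiction u≢v ¬uv

-- Any two old vertices lie in the complete part, so every non-edge contains the added vertex,
-- whatever `t` is.
K-nonEdgesMeet : ∀ t → NonEdgesMeet (K (suc n) t)
K-nonEdgesMeet t = zero , λ where
  zero    v       _   _   → inj₁ refl
  (suc u) zero    _   _   → inj₂ refl
  (suc u) (suc v) u≢v ¬uv → contradiction (u≢v ∘ cong suc) ¬uv

exceptional-nonEdgesMeet : ∀ {G : Graph (suc n)} → Exceptional G → NonEdgesMeet G
exceptional-nonEdgesMeet {n} {G} (inj₁ iso) =
  ≅-nonEdgesMeet G (complete (suc n)) iso complete-nonEdgesMeet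
exceptional-nonEdgesMeet {n} {G} (inj₂ (inj₁ iso)) =
  ≅-nonEdgesMeet G (K (suc n) 2) iso (K-nonEdgesMeet 2)
exceptional-nonEdgesMeet {n} {G} (inj₂ (inj₂ iso)) =
  ≅-nonEdgesMeet G (K (suc n) (suc n ∸ 2)) iso (K-nonEdgesMeet (suc n ∸ 2))

-- The graph and its metric.

discrete : Fin n → Fin n → ℕ
discrete u v = if does (u Fin.≟ v) then 0 else 1

discrete-≢ : ∀ {u v : Fin n} → u ≢ v → discrete u v ≡ 1
discrete-≢ {u = u} {v} u≢v with u Fin.≟ v
... | yes u≡v = contradiction u≡v u≢v
... | no  _   = refl

discrete-refl : ∀ (u : Fin n) → discrete u u ≡ 0
discrete-refl u with u Fin.≟ u
... | yes _   = refl
... | no  u≢u = contradiction refl u≢u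

discrete-sym : ∀ (u v : Fin n) → discrete u v ≡ discrete v u
discrete-sym u v with u Fin.≟ v
... | yes refl = sym (discrete-refl u)
... | no  u≢v  = sym (discrete-≢ (u≢v ∘ sym))

discrete≤1 : ∀ (u v : Fin n) → discrete u v ≤ 1
discrete≤1 u v with does (u Fin.≟ v)
... | true  = z≤n
... | false = s≤s z≤n

-- The vertices x , y , a , b are 0F , 1F , 2F , 3F, and cⱼ is c j.
pattern c j = suc (suc (suc (suc j)))

-- The catch-all covers b, reached through y, and every cⱼ, reached through a.
fromX : Fin (4 + m) → ℕ
fromX 0F = 0
fromX 1F = 1
fromX 2F = 1
fromX _  = 2

-- The catch-all covers a, reached through x, and every cⱼ, reached through b.
fromY : Fin (4 + m) → ℕ
fromY 0F = 1
fromY 1F = 0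
fromY 3F = 1
fromY _  = 2

distance : Fin (4 + m) → Fin (4 + m) → ℕ
distance 0F              v             = fromX v
distance 1F              v             = fromY v
distance u@(suc (suc _)) 0F            = fromX u
distance u@(suc (suc _)) 1F            = fromY u
distance (suc (suc u))   (suc (suc v)) = discrete u v

distance-sym : ∀ (u v : Fin (4 + m)) → distance u v ≡ distance v u
distance-sym 0F            0F            = refl
distance-sym 0F            1F            = refl
distance-sym 0F            (suc (suc v)) = refl
distance-sym 1F            0F            = refl
distance-sym 1F            1F            = refl
distance-sym 1F            (suc (suc v)) = refl
distance-sym (suc (suc u)) 0F            = refl
distance-sym (suc (suc u)) 1F            = refl
distance-sym (suc (suc u)) (suc (suc v)) = discrete-sym u v

distance-refl : ∀ (u : Fin (4 + m)) → distance u u ≡ 0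
distance-refl 0F            = refl
distance-refl 1F            = refl
distance-refl (suc (suc u)) = discrete-refl u

fromX≤2 : ∀ (v : Fin (4 + m)) → fromX v ≤ 2
fromX≤2 0F                  = z≤n
fromX≤2 1F                  = s≤s z≤n
fromX≤2 2F                  = s≤s z≤n
fromX≤2 (suc (suc (suc v))) = s≤s (s≤s z≤n)

fromY≤2 : ∀ (v : Fin (4 + m)) → fromY v ≤ 2
fromY≤2 0F    = s≤s z≤n
fromY≤2 1F    = z≤n
fromY≤2 2F    = s≤s (s≤s z≤n)
fromY≤2 3F    = s≤s z≤n
fromY≤2 (c v) = s≤s (s≤s z≤n)

distance≤2 : ∀ (u v : Fin (4 + m)) → distance u v ≤ 2
distance≤2 0F              v             = fromX≤2 v
distance≤2 1F              v             = fromY≤2 v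
distance≤2 u@(suc (suc _)) 0F            = fromX≤2 u
distance≤2 u@(suc (suc _)) 1F            = fromY≤2 u
distance≤2 (suc (suc u))   (suc (suc v)) = ≤-trans (discrete≤1 u v) (s≤s z≤n)

-- The metric comes first and the edges are its pairs at distance 1, so adjacency reduces along with
-- `distance`.
handledClique : ∀ m → Graph (4 + m)
handledClique m = record
  { Adj    = λ u v → distance u v ≡ 1
  ; adj?   = λ u v → distance u v ≟ 1
  ; symm   = λ {u} {v} → trans (distance-sym v u)
  ; irrefl = λ v e → contradiction (trans (sym (distance-refl v)) e) λ ()
  }

walk-distance : ∀ (u v : Fin (4 + m)) → Walk (handledClique m) (distance u v) u v
walk-distance 0F                0F            = ε
walk-distance 0F                1F            = refl ◅ ε
walk-distance 0F                2F            = refl ◅ ε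
walk-distance 0F                3F            = _◅_ {v = 1F} refl (refl ◅ ε)
walk-distance 0F                (c _)         = _◅_ {v = 2F} refl (refl ◅ ε)
walk-distance 1F                0F            = refl ◅ ε
walk-distance 1F                1F            = ε
walk-distance 1F                2F            = _◅_ {v = 0F} refl (refl ◅ ε)
walk-distance 1F                3F            = refl ◅ ε
walk-distance 1F                (c _)         = _◅_ {v = 3F} refl (refl ◅ ε)
walk-distance 2F                0F            = refl ◅ ε
walk-distance 2F                1F            = _◅_ {v = 0F} refl (refl ◅ ε)
walk-distance 3F                0F            = _◅_ {v = 1F} refl (refl ◅ ε)
walk-distance 3F                1F            = refl ◅ ε
walk-distance (c _)             0F            = _◅_ {v = 2F} refl (refl ◅ ε)
walk-distance (c _)             1F            = _◅_ {v = 3F} refl (refl ◅ ε)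
walk-distance {m} (suc (suc u)) (suc (suc v)) = clique (u Fin.≟ v)
  where
  -- Generalising over the decision inside `discrete` lets the walk length reduce by matching.
  clique : (u≟v : Dec (u ≡ v)) →
           Walk (handledClique m) (if does u≟v then 0 else 1) (suc (suc u)) (suc (suc v))
  clique (yes refl) = ε
  clique (no u≢v)   = discrete-≢ u≢v ◅ ε

-- Length 0 forces equal ends and length 1 is adjacency; from length 2 on the diameter bound
-- suffices.
distance≤length : ∀ {k} {u v : Fin (4 + m)} → Walk (handledClique m) k u v → distance u v ≤ k
distance≤length {u = u}         ε           = subst (_≤ 0) (sym (distance-refl u)) z≤n
distance≤length                 (e ◅ ε)     = subst (_≤ 1) (sym e) (s≤s z≤n)
distance≤length {u = u} {v = v} (_ ◅ _ ◅ _) = ≤-trans (distance≤2 u v) (s≤s (s≤s z≤n))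

connected : Connected (handledClique m)
connected u v = distance u v , walk-distance u v

dist≡distance : ∀ (conn : Connected (handledClique m)) u v →
           dist (handledClique m) conn u v ≡ distance u v
dist≡distance conn u v = dist-unique (handledClique _) conn (walk-distance u v) distance≤length

-- 2-connectedness and unexceptionality.

delete-connected : ∀ (v : Fin (5 + m)) → Connected (delete (handledClique (suc m)) v)
delete-connected {m} v = hub-connected (delete (handledClique (suc m)) v) (hub v) (toHub v)
  where
  -- The hub is b if x or a is deleted and a otherwise, in the numbering after the deletion.
  hub : Fin (5 + m) → Fin (4 + m)
  hub 0F                  = 2F
  hub 1F                  = 1F
  hub 2F                  = 2F
  hub (suc (suc (suc v))) = 2F

  toHub : ∀ v u → ∃ λ k → Walk (delete (handledClique (suc m)) v) k u (hub v)
  toHub 0F 0F = 1 , refl ◅ ε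
  toHub 0F 1F = 1 , refl ◅ ε
  toHub 0F 2F = 0 , ε
  toHub 0F (suc (suc (suc u))) = 1 , refl ◅ ε
  toHub 1F 0F = 1 , refl ◅ ε
  toHub 1F 1F = 0 , ε
  toHub 1F (suc (suc u)) = 1 , refl ◅ ε
  -- When x and y both survive, the one not adjacent to the hub goes through the other; likewise
  -- below.
  toHub 2F 0F = 2 , _◅_ {v = 1F} refl (refl ◅ ε)
  toHub 2F 1F = 1 , refl ◅ ε
  toHub 2F 2F = 0 , ε
  toHub 2F (suc (suc (suc u))) = 1 , refl ◅ ε
  toHub 3F 0F = 1 , refl ◅ ε
  toHub 3F 1F = 2 , _◅_ {v = 0F} refl (refl ◅ ε)
  toHub 3F 2F = 0 , ε
  toHub 3F (suc (suc (suc u))) = 1 , refl ◅ ε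
  toHub (c v) 0F = 1 , refl ◅ ε
  toHub (c v) 1F = 2 , _◅_ {v = 0F} refl (refl ◅ ε)
  toHub (c v) 2F = 0 , ε
  toHub (c v) 3F = 1 , refl ◅ ε
  toHub (c v) (c u) = 1 , refl ◅ ε

twoConnected : TwoConnected (handledClique (suc m))
twoConnected = record
  { order≥3     = s≤s (s≤s (s≤s z≤n))
  ; connected   = connected
  ; noCutVertex = delete-connected
  }

unexceptional : Unexceptional (handledClique m)
unexceptional {m} exc with exceptional-nonEdgesMeet {G = handledClique m} exc
-- The non-edge {x , b} makes `z` equal to x or b, and {y , a} contains neither.
... | z , meet with meet 0F 3F (λ ()) (λ ()) | meet 1F 2F (λ ()) (λ ())
...   | inj₁ refl | inj₁ ()
...   | inj₁ refl | inj₂ ()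
...   | inj₂ refl | inj₁ ()
...   | inj₂ refl | inj₂ ()

-- Abstracting over the connectedness proof keeps dist from unfolding.
module _ (m : ℕ) (conn : Connected (handledClique m)) where

  private
    G = handledClique m

    cl : Fin (4 + m) → Fin (4 + m) → ℕ
    cl = closer G conn

    indicators : ∀ a b →
      cl a b ≡ ∑[ w < 4 + m ] (if does (distance w a <? distance w b) then 1 else 0)
    indicators = closer-∑ G conn {d = distance} (dist≡distance conn)

    -- Left unevaluated, since it cancels in the difference of the indices.
    R : ℕ
    R = sumPairs {m} λ _ _ → 1

  -- The counts at the two ends of each edge.

  closer-xy : cl 0F 1F ≡ 2
  -- The terms of x , y , a , b compute to the constant 2, here from x and a; what remains is the
  -- sum over the cⱼ.
  closer-xy = trans (indicators 0F 1F) (cong (_+_ 2) (∑-zero {m} λ _ → refl))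

  closer-yx : cl 1F 0F ≡ 2
  closer-yx = trans (indicators 1F 0F) (cong (_+_ 2) (∑-zero {m} λ _ → refl))

  closer-xa : cl 0F 2F ≡ 2
  closer-xa = trans (indicators 0F 2F) (cong (_+_ 2) (∑-zero {m} λ _ → refl))

  -- The whole clique lies closer to a than to x.
  closer-ax : cl 2F 0F ≡ 2 + m
  closer-ax = trans (indicators 2F 0F) (cong (_+_ 2) (∑-one {m} λ _ → refl))

  closer-yb : cl 1F 3F ≡ 2
  closer-yb = trans (indicators 1F 3F) (cong (_+_ 2) (∑-zero {m} λ _ → refl))

  closer-by : cl 3F 1F ≡ 2 + m
  closer-by = trans (indicators 3F 1F) (cong (_+_ 2) (∑-one {m} λ _ → refl))

  closer-ab : cl 2F 3F ≡ 2
  closer-ab = trans (indicators 2F 3F) (cong (_+_ 2) (∑-zero {m} λ _ → refl))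

  closer-ba : cl 3F 2F ≡ 2
  closer-ba = trans (indicators 3F 2F) (cong (_+_ 2) (∑-zero {m} λ _ → refl))

  -- Every clique vertex other than a is at distance 1 from a, so no cₖ is closer to a than to cⱼ;
  -- the same holds for b.
  1≮discrete : ∀ (i j : Fin m) → (if does (1 <? discrete i j) then 1 else 0) ≡ 0
  1≮discrete i j with does (i Fin.≟ j)
  ... | true  = refl
  ... | false = refl

  discrete<1 : ∀ (i j : Fin m) →
    (if does (discrete j i <? 1) then 1 else 0) ≡ (if does (j Fin.≟ i) then 1 else 0)
  discrete<1 i j with does (j Fin.≟ i)
  ... | true  = refl
  ... | false = refl

  -- Any third cₖ is equidistant from cᵢ and cⱼ, so only cᵢ itself counts.
  discrete<discrete : ∀ {i j : Fin m} → i ≢ j → ∀ k →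
    (if does (discrete k i <? discrete k j) then 1 else 0) ≡ (if does (k Fin.≟ i) then 1 else 0)
  discrete<discrete {i} {j} i≢j k with k Fin.≟ i | k Fin.≟ j
  ... | yes refl | yes i≡j = contradiction i≡j i≢j
  ... | yes _    | no  _   = refl
  ... | no  _    | yes _   = refl
  ... | no  _    | no  _   = refl

  closer-ac : ∀ j → cl 2F (c j) ≡ 2
  closer-ac j = trans (indicators 2F (c j)) (cong (_+_ 2) (∑-zero {m} λ k → 1≮discrete k j))

  closer-bc : ∀ j → cl 3F (c j) ≡ 2
  closer-bc j = trans (indicators 3F (c j)) (cong (_+_ 2) (∑-zero {m} λ k → 1≮discrete k j))

  closer-ca : ∀ j → cl (c j) 2F ≡ 1
  closer-ca j =
    trans (indicators (c j) 2F) (trans (sum-cong-≗ {m} (discrete<1 j)) (∑-indicator j))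

  closer-cb : ∀ j → cl (c j) 3F ≡ 1
  closer-cb j =
    trans (indicators (c j) 3F) (trans (sum-cong-≗ {m} (discrete<1 j)) (∑-indicator j))

  closer-cc : ∀ {i j} → i ≢ j → cl (c i) (c j) ≡ 1
  closer-cc {i} {j} i≢j =
    trans (indicators (c i) (c j))
    (trans (sum-cong-≗ {m} (discrete<discrete i≢j)) (∑-indicator i))

  -- The two indices and their difference.

  wiener-value : wiener G conn ≡ 8 + 6 * m + R
  wiener-value =
    trans (sumPairs-cong {f = dist G conn} {distance} λ u v _ → dist≡distance conn u v)
    (trans (sumPairs-rows {m} distance rowX rowY rowA rowB block) (arith m R))
    where
    -- The 4 is 1 + 1 + 2, from y , a and b.
    rowX : ∑[ v < 3 + m ] distance {m} 0F (suc v) ≡ 4 + m * 2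
    rowX = cong (_+_ 4) (∑-const {m} λ _ → refl)

    rowY : ∑[ v < 2 + m ] distance {m} 1F (suc (suc v)) ≡ 3 + m * 2
    rowY = cong (_+_ 3) (∑-const {m} λ _ → refl)

    rowA : ∑[ v < 1 + m ] distance {m} 2F (suc (suc (suc v))) ≡ 1 + m
    rowA = cong suc (∑-one {m} λ _ → refl)

    rowB : ∑[ j < m ] distance {m} 3F (c j) ≡ m
    rowB = ∑-one {m} λ _ → refl

    block : sumPairs {m} (λ i j → distance (c i) (c j)) ≡ R
    block = sumPairs-cong {m} λ i j i≢j → discrete-≢ i≢j

    arith : ∀ m r → 4 + m * 2 + (3 + m * 2 + (1 + m + (m + r))) ≡ 8 + 6 * m + r
    arith = solve-∀

  szeged-value : szeged G conn ≡ 16 + 8 * m + R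
  szeged-value =
    trans (sumPairs-rows {m} weight rowX rowY rowA rowB block) (arith m R)
    where
    weight : Fin (4 + m) → Fin (4 + m) → ℕ
    weight u v = if does (adj? G u v) then cl u v * cl v u else 0

    -- Edge xy gives 2 * 2 and xa gives 2 * (2 + m); the final 0 is the sum over the cⱼ, none
    -- adjacent to x.
    rowX : ∑[ v < 3 + m ] weight 0F (suc v) ≡ 4 + (2 * (2 + m) + 0)
    rowX = cong₂ _+_ (cong₂ _*_ closer-xy closer-yx)
      (cong₂ _+_ (cong₂ _*_ closer-xa closer-ax) (∑-zero {m} λ _ → refl))

    rowY : ∑[ v < 2 + m ] weight 1F (suc (suc v)) ≡ 2 * (2 + m) + 0
    rowY = cong₂ _+_ (cong₂ _*_ closer-yb closer-by) (∑-zero {m} λ _ → refl)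

    rowA : ∑[ v < 1 + m ] weight 2F (suc (suc (suc v))) ≡ 4 + m * 2
    rowA = cong₂ _+_ (cong₂ _*_ closer-ab closer-ba)
      (∑-const λ j → cong₂ _*_ (closer-ac j) (closer-ca j))

    rowB : ∑[ j < m ] weight 3F (c j) ≡ m * 2
    rowB = ∑-const λ j → cong₂ _*_ (closer-bc j) (closer-cb j)

    block : sumPairs {m} (λ i j → weight (c i) (c j)) ≡ R
    block = sumPairs-cong λ i j i≢j → trans
      -- The adjacency test is stuck on `discrete i j` until i ≢ j resolves it; the edge then weighs
      -- 1 * 1.
      (cong (λ d → if does (d ≟ 1) then cl (c i) (c j) * cl (c j) (c i) else 0)
        (discrete-≢ i≢j))
      (cong₂ _*_ (closer-cc i≢j) (closer-cc (i≢j ∘ sym)))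

    arith : ∀ m r →
      4 + (2 * (2 + m) + 0) + (2 * (2 + m) + 0 + (4 + m * 2 + (m * 2 + r))) ≡ 16 + 8 * m + r
    arith = solve-∀

  η-value : η G conn ≡ + (2 * (4 + m))
  η-value = +-difference
    (trans szeged-value
    (trans (arith m R) (cong (λ w → w + 2 * (4 + m)) (sym wiener-value))))
    where
    arith : ∀ m r → 16 + 8 * m + r ≡ 8 + 6 * m + r + 2 * (4 + m)
    arith = solve-∀

-- Taking the 2-connectedness proof as an argument likewise keeps η from being evaluated.
handledClique-η : ∀ m → TwoConnected (handledClique m) →
  Σ[ G ∈ Graph (4 + m) ] Σ[ tc ∈ TwoConnected G ]
    (Unexceptional G × η G (TwoConnected.connected tc) ≡ + (2 * (4 + m)))
handledClique-η m tc =
  handledClique m , tc , unexceptional , η-value m (TwoConnected.connected tc)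

lemma8 : (n : ℕ) → n ≥ 10 →
    Σ[ G ∈ Graph n ] Σ[ tc ∈ TwoConnected G ]
    (Unexceptional G × η G (TwoConnected.connected tc) ≡ + (2 * n))
lemma8 n n≥10 with m≤n⇒∃[o]m+o≡n n≥10
-- Here n is 10 + k, so the number m of vertices cⱼ is n - 4, that is 6 + k.
... | k , refl = handledClique-η (6 + k) twoConnected
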